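{- Let $G$ be a finite simple graph of order $n\ge 4$ without isolated vertices and with maximum degree $\Delta(G)=n-3$. Fix a vertex $v$ with $\deg(v)=\Delta(G)$. (i) If $G$ is disconnected, then $\gamma_t(G)=4$ and $TDV(v)=n-3$. (ii) If $G$ is connected, then either $\gamma_t(G)=2$ and $TDV(v)\le n-3$, or $\gamma_t(G)=3$ and $TDV(v)\le \left(\frac{n-3}{2}\right)^2+2(n-4)$.
   Context: A set $D \subseteq V(G)$ is a total dominating set of $G$ if every vertex of $G$ has a neighbor in $D$. $\gamma_t(G)$ is the minimum cardinality of a total dominating set; a minimum one is a $\gamma_t(G)$-set. $TDV(v)$ is the number of $\gamma_t(G)$-sets containing $v$. -}

module Defs where

open import Data.Fin using (Fin)
open import Data.Fin.Properties using (any?; all?)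
open import Data.Fin.Subset using (Subset; inside; outside; _∈_; ∣_∣)
open import Data.Fin.Subset.Properties using (_∈?_)
open import Data.List using (List; []; _∷_; _++_; map; filter; length; allFin)
open import Data.List.Extrema.Nat using (min; max)
open import Data.Nat using (ℕ; zero; suc; _≟_)
open import Data.Product using (_×_; ∃)
open import Data.Vec using (tabulate) renaming ([] to []ᵥ; _∷_ to _∷ᵥ_)
open import Relation.Binary.Construct.Closure.ReflexiveTransitive using (Star)
open import Relation.Binary.PropositionalEquality using (_≡_)
open import Relation.Nullary using (¬_; Dec; does)
open import Relation.Nullary.Decidable using (_×-dec_)

-- Adjacency is decidable because degrees and numbers of vertex sets are counted.
record Graph (n : ℕ) : Set₁ where
  field
    Adj        : Fin n → Fin n → Set
    adj?       : ∀ u v → Dec (Adj u v)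
    adj-sym    : ∀ {u v} → Adj u v → Adj v u
    adj-irrefl : ∀ {u} → ¬ Adj u u

subsets : ∀ n → List (Subset n)
subsets zero    = []ᵥ ∷ []
subsets (suc n) = map (outside ∷ᵥ_) (subsets n) ++ map (inside ∷ᵥ_) (subsets n)

module _ {n : ℕ} (G : Graph n) where
  open Graph G

  neighbourhood : Fin n → Subset n
  neighbourhood v = tabulate (λ u → does (adj? v u))

  degree : Fin n → ℕ
  degree v = ∣ neighbourhood v ∣

  -- The 0 only matters when n = 0.
  Δ : ℕ
  Δ = max 0 (map degree (allFin n))

  NoIsolatedVertices : Set
  NoIsolatedVertices = ∀ u → ∃ λ w → Adj u w

  Connected : Set
  Connected = ∀ u w → Star Adj u w

  TotalDominating : Subset n → Set
  TotalDominating D = ∀ u → ∃ λ w → w ∈ D × Adj u w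

  totalDominating? : ∀ D → Dec (TotalDominating D)
  totalDominating? D = all? λ u → any? λ w → (w ∈? D) ×-dec adj? u w

  -- Without isolated vertices the full vertex set, of cardinality n, is total
  -- dominating, so the base value n does not affect the minimum.  With an
  -- isolated vertex there is no total dominating set and γt is a junk value n.
  γt : ℕ
  γt = min n (map ∣_∣ (filter totalDominating? (subsets n)))

  γtSet : Subset n → Set
  γtSet D = TotalDominating D × ∣ D ∣ ≡ γt

  γtSet? : ∀ D → Dec (γtSet D)
  γtSet? D = totalDominating? D ×-dec (∣ D ∣ ≟ γt)

  TDV : Fin n → ℕ
  TDV v = length (filter (λ D → γtSet? D ×-dec (v ∈? D)) (subsets n))

{-# OPTIONS --safe #-}

-- Let y and z be the two non-neighbours of v. The graph is connected exactly when some
-- neighbour a of v is adjacent to y or z; then, with w any neighbour of the other one,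
-- {v, a, w} is total dominating, so γt ≤ 3. Otherwise {y, z} is a component and the minimum
-- total dominating sets through v are the {y, z, v, a} with a ∈ N(v).
-- If γt = 3, then no vertex is adjacent to all of v, y and z, so Y = N(v) ∩ N(y) and
-- Z = N(v) ∩ N(z) are disjoint, and a γt-set through v is one of {v, a, b}, {v, y, a},
-- {v, z, b} with a ∈ Y and b ∈ Z. Hence TDV(v) ≤ |Y||Z| + |Y| + |Z| with |Y| + |Z| ≤ n − 3,
-- and n ≥ 5 since a vertex adjacent to v and to y or z has degree at least 2.
module Submission where

open import Defs
open import Data.Empty using (⊥-elim)
open import Data.Fin using (Fin; zero; suc)
open import Data.Fin.Properties using (any?)
import Data.Fin.Properties as Fin
open import Data.Fin.Subset using (Subset; inside; outside; _∈_; _⊆_; _∩_; _∪_; ∁; ⁅_⁆; ∣_∣)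
  renaming (⊥ to ∅)
open import Data.Fin.Subset.Properties
  using (∉⊥; x∈⁅x⁆; x∈⁅y⁆⇒x≡y; x∈p∪q⁺; x∈p∪q⁻; x∈p∩q⁺; x∈p∩q⁻; x∈∁p⇒x∉p; x∉p⇒x∈∁p;
         ∣∁p∣≡n∸∣p∣; ⊆-antisym; _∈?_)
open import Data.Integer using (+_)
import Data.Integer as ℤ
import Data.Integer.Properties as ℤ
open import Data.List using (List; []; _∷_; _++_; map; foldr; length; cartesianProductWith)
open import Data.List.Extrema.Nat using (min≤v⁺; v≤min⁺; v≤max⁺)
open import Data.List.Membership.Propositional using (lose) renaming (_∈_ to _∈ₗ_)
open import Data.List.Membership.DecPropositional using () renaming (_∈?_ to mem?)
open import Data.List.Membership.Propositional.Properties
  using (∈-map⁺; ∈-map⁻; ∈-++⁺ˡ; ∈-++⁺ʳ; ∈-++⁻; ∈-∃++; ∈-filter⁺; ∈-filter⁻; ∈-allFin;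
         ∈-cartesianProductWith⁺)
open import Data.List.Properties using (length-map; length-++; length-++-sucʳ)
open import Data.List.Relation.Unary.All as All using (All; []; _∷_)
import Data.List.Relation.Unary.All.Properties as All
open import Data.List.Relation.Unary.AllPairs using ([]; _∷_)
open import Data.List.Relation.Unary.Any using (here; there)
open import Data.List.Relation.Unary.Unique.Propositional using (Unique)
import Data.List.Relation.Unary.Unique.Propositional.Properties as Unique
open import Data.Nat using (ℕ; zero; suc; _+_; _*_; _≤_; _∸_; z≤n; s≤s)
open import Data.Nat.Properties
open import Data.Nat.Tactic.RingSolver using (solve-∀)
open import Data.Product using (_×_; _,_; ∃; ∃₂; proj₁; proj₂)
open import Data.Rational.Unnormalised using (_/_; *≤*) renaming (_≤_ to _≤ℚ_; _+_ to _+ℚ_; _*_ to _*ℚ_)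
open import Data.Sum using (_⊎_; inj₁; inj₂; map₂; swap)
open import Data.Vec.Properties using (∷-injectiveʳ; lookup∘tabulate; []=⇒lookup; lookup⇒[]=)
open import Data.Vec using () renaming ([] to []ᵥ; _∷_ to _∷ᵥ_; here to hereᵥ; there to thereᵥ)
open import Function using (id; _∘_; case_of_)
open import Level using (Level)
open import Relation.Binary.Construct.Closure.ReflexiveTransitive using (Star; ε; _◅_; _◅◅_; reverse)
open import Relation.Binary.PropositionalEquality
open import Relation.Nullary using (¬_; yes; no; contradiction)
open import Relation.Nullary.Decidable using (_×-dec_; _⊎-dec_; dec-true)

-- Counting with duplicate-free lists.

private
  variable
    ℓ ℓ′ : Level
    A : Set ℓ
    B : Set ℓ′
    n : ℕ

-- By induction: deleting one occurrence of `f x` from `ys` leaves room for the images of the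
-- remaining entries, since by injectivity none of them equals `f x`. Injectivity is asked on the
-- entries of `xs` only, because the map sending `a` to {y, z, v, a} is injective on neighbours of
-- `v` but not on all vertices.
pigeonhole : {xs : List A} {ys : List B} (f : A → B) → Unique xs →
  (∀ {x} → x ∈ₗ xs → f x ∈ₗ ys) →
  (∀ {x x′} → x ∈ₗ xs → x′ ∈ₗ xs → f x ≡ f x′ → x ≡ x′) →
  length xs ≤ length ys
pigeonhole {xs = []} f _ _ _ = z≤n
pigeonhole {xs = x ∷ xs} {ys} f (x∉xs ∷ uxs) f∈ys inj with ∈-∃++ (f∈ys (here refl))
... | as , bs , refl = begin
  suc (length xs)           ≤⟨ s≤s (pigeonhole f uxs f∈rest λ p q → inj (there p) (there q)) ⟩
  suc (length (as ++ bs))   ≡⟨ length-++-sucʳ as (f x) bs ⟨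
  length (as ++ f x ∷ bs)   ∎
  where
  open ≤-Reasoning
  f∈rest : ∀ {x′} → x′ ∈ₗ xs → f x′ ∈ₗ as ++ bs
  f∈rest p with ∈-++⁻ as (f∈ys (there p))
  ... | inj₁ q         = ∈-++⁺ˡ q
  ... | inj₂ (here eq) = contradiction (inj (here refl) (there p) (sym eq)) (All.lookup x∉xs p)
  ... | inj₂ (there q) = ∈-++⁺ʳ as q

⊆⇒length≤ : {xs ys : List A} → Unique xs → (∀ {x} → x ∈ₗ xs → x ∈ₗ ys) → length xs ≤ length ys
⊆⇒length≤ uxs xs⊆ys = pigeonhole id uxs xs⊆ys λ _ _ → id

length-cartesianProductWith : {C : Set ℓ} (f : A → B → C) (xs : List A) (ys : List B) →
  length (cartesianProductWith f xs ys) ≡ length xs * length ys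
length-cartesianProductWith f []       ys = refl
length-cartesianProductWith f (x ∷ xs) ys = trans (length-++ (map (f x) ys))
  (cong₂ _+_ (length-map (f x) ys) (length-cartesianProductWith f xs ys))

-- Passing between vertex subsets and lists.

elements : Subset n → List (Fin n)
elements []ᵥ             = []
elements (inside  ∷ᵥ p)  = zero ∷ map suc (elements p)
elements (outside ∷ᵥ p)  = map suc (elements p)

length-elements : (p : Subset n) → length (elements p) ≡ ∣ p ∣
length-elements []ᵥ            = refl
length-elements (inside  ∷ᵥ p) = cong suc (trans (length-map suc (elements p)) (length-elements p))
length-elements (outside ∷ᵥ p) = trans (length-map suc (elements p)) (length-elements p)

∈-elements⁺ : {p : Subset n} {x : Fin n} → x ∈ p → x ∈ₗ elements p
∈-elements⁺ {p = inside  ∷ᵥ p} hereᵥ       = here refl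
∈-elements⁺ {p = inside  ∷ᵥ p} (thereᵥ x∈) = there (∈-map⁺ suc (∈-elements⁺ x∈))
∈-elements⁺ {p = outside ∷ᵥ p} (thereᵥ x∈) = ∈-map⁺ suc (∈-elements⁺ x∈)

∈-elements⁻ : (p : Subset n) {x : Fin n} → x ∈ₗ elements p → x ∈ p
∈-elements⁻ (inside  ∷ᵥ p) (here refl) = hereᵥ
∈-elements⁻ (inside  ∷ᵥ p) (there q) with ∈-map⁻ suc q
... | _ , x∈ , refl = thereᵥ (∈-elements⁻ p x∈)
∈-elements⁻ (outside ∷ᵥ p) q with ∈-map⁻ suc q
... | _ , x∈ , refl = thereᵥ (∈-elements⁻ p x∈)

elements-unique : (p : Subset n) → Unique (elements p)
elements-unique []ᵥ            = []
elements-unique (inside  ∷ᵥ p) =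
  All.map⁺ (All.universal (λ _ ()) (elements p)) ∷ Unique.map⁺ Fin.suc-injective (elements-unique p)
elements-unique (outside ∷ᵥ p) = Unique.map⁺ Fin.suc-injective (elements-unique p)

length≤∣_∣ : (p : Subset n) {xs : List (Fin n)} → Unique xs → All (_∈ p) xs → length xs ≤ ∣ p ∣
length≤∣ p ∣ uxs xs⊆p = subst (_ ≤_) (length-elements p)
  (⊆⇒length≤ uxs λ x∈xs → ∈-elements⁺ (All.lookup xs⊆p x∈xs))

-- The elements of `p ∩ q` followed by those of `p ∩ r` form a duplicate-free list inside `p`. With
-- three neighbourhoods this becomes |Y| + |Z| ≤ deg(v).
disjoint-∩-≤ : (p q r : Subset n) → (∀ {x} → x ∈ p → x ∈ q → ¬ x ∈ r) → ∣ p ∩ q ∣ + ∣ p ∩ r ∣ ≤ ∣ p ∣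
disjoint-∩-≤ p q r disj = begin
  ∣ p ∩ q ∣ + ∣ p ∩ r ∣
    ≡⟨ cong₂ _+_ (length-elements (p ∩ q)) (length-elements (p ∩ r)) ⟨
  length (elements (p ∩ q)) + length (elements (p ∩ r))
    ≡⟨ length-++ (elements (p ∩ q)) ⟨
  length (elements (p ∩ q) ++ elements (p ∩ r))
    ≤⟨ length≤∣ p ∣ (Unique.++⁺ (elements-unique (p ∩ q)) (elements-unique (p ∩ r)) disj′)
         (All.++⁺ (All.tabulate λ x∈ → proj₁ (x∈p∩q⁻ p q (∈-elements⁻ (p ∩ q) x∈)))
                  (All.tabulate λ x∈ → proj₁ (x∈p∩q⁻ p r (∈-elements⁻ (p ∩ r) x∈)))) ⟩
  ∣ p ∣ ∎
  where
  open ≤-Reasoning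
  disj′ : ∀ {x} → ¬ (x ∈ₗ elements (p ∩ q) × x ∈ₗ elements (p ∩ r))
  disj′ (x∈q , x∈r) with x∈p∩q⁻ p q (∈-elements⁻ (p ∩ q) x∈q) | x∈p∩q⁻ p r (∈-elements⁻ (p ∩ r) x∈r)
  ... | x∈p , x∈q′ | _ , x∈r′ = disj x∈p x∈q′ x∈r′

fromList : List (Fin n) → Subset n
fromList = foldr (λ x p → ⁅ x ⁆ ∪ p) ∅

∈-fromList⁺ : (xs : List (Fin n)) {x : Fin n} → x ∈ₗ xs → x ∈ fromList xs
∈-fromList⁺ (y ∷ xs) (here refl) = x∈p∪q⁺ (inj₁ (x∈⁅x⁆ y))
∈-fromList⁺ (y ∷ xs) (there x∈)  = x∈p∪q⁺ (inj₂ (∈-fromList⁺ xs x∈))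

∈-fromList⁻ : (xs : List (Fin n)) {x : Fin n} → x ∈ fromList xs → x ∈ₗ xs
∈-fromList⁻ []       x∈ = contradiction x∈ ∉⊥
∈-fromList⁻ (y ∷ xs) x∈ with x∈p∪q⁻ ⁅ y ⁆ (fromList xs) x∈
... | inj₁ x∈y  = here (x∈⁅y⁆⇒x≡y y x∈y)
... | inj₂ x∈xs = there (∈-fromList⁻ xs x∈xs)

-- Repeated entries collapse, so equality can fail: in `bridge⇒γt≤3` the chosen neighbour of `z` may
-- be `a` itself.
∣fromList∣≤length : (xs : List (Fin n)) → ∣ fromList xs ∣ ≤ length xs
∣fromList∣≤length xs = subst (_≤ length xs) (length-elements (fromList xs))
  (⊆⇒length≤ (elements-unique (fromList xs)) λ x∈ → ∈-fromList⁻ xs (∈-elements⁻ (fromList xs) x∈))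

∣fromList∣≡length : {xs : List (Fin n)} → Unique xs → ∣ fromList xs ∣ ≡ length xs
∣fromList∣≡length {xs = xs} uxs = ≤-antisym (∣fromList∣≤length xs)
  (length≤∣ fromList xs ∣ uxs (All.tabulate (∈-fromList⁺ xs)))

-- An element of `p` outside `xs` would extend `xs` to a duplicate-free list in `p` longer than the
-- cardinality of `p`. This identifies a γt-set once enough distinct members are known.
≡fromList : (p : Subset n) {xs : List (Fin n)} → Unique xs → All (_∈ p) xs → ∣ p ∣ ≡ length xs →
  p ≡ fromList xs
≡fromList p {xs} uxs xs⊆p ∣p∣≡ = ⊆-antisym p⊆xs λ x∈ → All.lookup xs⊆p (∈-fromList⁻ xs x∈)
  where
  p⊆xs : p ⊆ fromList xs
  p⊆xs {x} x∈p with mem? Fin._≟_ x xs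
  ... | yes x∈xs = ∈-fromList⁺ xs x∈xs
  ... | no  x∉xs = contradiction
    (subst (suc (length xs) ≤_) ∣p∣≡ (length≤∣ p ∣ (All.¬Any⇒All¬ xs x∉xs ∷ uxs) (x∈p ∷ xs⊆p)))
    1+n≰n

-- The enumeration of all subsets is complete and has no repetitions.

∈-subsets : (p : Subset n) → p ∈ₗ subsets n
∈-subsets []ᵥ            = here refl
∈-subsets (outside ∷ᵥ p) = ∈-++⁺ˡ (∈-map⁺ (outside ∷ᵥ_) (∈-subsets p))
∈-subsets (inside  ∷ᵥ p) = ∈-++⁺ʳ (map (outside ∷ᵥ_) (subsets _)) (∈-map⁺ (inside ∷ᵥ_) (∈-subsets p))

subsets-unique : ∀ n → Unique (subsets n)
subsets-unique zero    = [] ∷ []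
subsets-unique (suc n) = Unique.++⁺ (Unique.map⁺ ∷-injectiveʳ (subsets-unique n))
  (Unique.map⁺ ∷-injectiveʳ (subsets-unique n)) λ (p , q) → heads-differ p q
  where
  heads-differ : ∀ {p} → p ∈ₗ map (outside ∷ᵥ_) (subsets n) → ¬ p ∈ₗ map (inside ∷ᵥ_) (subsets n)
  heads-differ p q with ∈-map⁻ (outside ∷ᵥ_) p | ∈-map⁻ (inside ∷ᵥ_) q
  ... | _ , _ , refl | _ , _ , ()

-- Bounds for `γt` and `TDV` in an arbitrary graph.

module _ (G : Graph n) where
  open Graph G

  ∈-neighbourhood⁺ : ∀ {u w} → Adj u w → w ∈ neighbourhood G u
  ∈-neighbourhood⁺ {u} {w} a = lookup⇒[]= w _ (trans (lookup∘tabulate _ w) (dec-true (adj? u w) a))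

  ∈-neighbourhood⁻ : ∀ {u w} → w ∈ neighbourhood G u → Adj u w
  ∈-neighbourhood⁻ {u} {w} w∈ with adj? u w | trans (sym (lookup∘tabulate _ w)) ([]=⇒lookup w∈)
  ... | yes a | _  = a
  ... | no _  | ()

  -- For the non-neighbours y and z of v, `codegree v y` and `codegree v z` are |Y| and |Z|.
  codegree : Fin n → Fin n → ℕ
  codegree u w = ∣ neighbourhood G u ∩ neighbourhood G w ∣

  Adj⇒≢ : ∀ {u w} → Adj u w → u ≢ w
  Adj⇒≢ a refl = adj-irrefl a

  degree≤Δ : ∀ u → degree G u ≤ Δ G
  degree≤Δ u = v≤max⁺ 0 _ (inj₂ (lose (∈-map⁺ (degree G) (∈-allFin u)) ≤-refl))

  γt≤ : ∀ {D} → TotalDominating G D → γt G ≤ ∣ D ∣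
  γt≤ {D} td = min≤v⁺ n _ (inj₂ (lose (∈-map⁺ ∣_∣ (∈-filter⁺ (totalDominating? G) (∈-subsets D) td)) ≤-refl))

  -- The hypothesis `k ≤ n` accounts for the base value `n` of the minimum defining `γt`.
  ≤γt : ∀ {k} → k ≤ n → (∀ {D} → TotalDominating G D → k ≤ ∣ D ∣) → k ≤ γt G
  ≤γt k≤n bound = v≤min⁺ k≤n
    (All.map⁺ (All.tabulate λ D∈ → bound (proj₂ (∈-filter⁻ (totalDominating? G) {xs = subsets n} D∈))))

  module _ (v : Fin n) where

    TDV≤ : (Ds : List (Subset n)) → (∀ {D} → γtSet G D → v ∈ D → D ∈ₗ Ds) → TDV G v ≤ length Ds
    TDV≤ Ds complete = ⊆⇒length≤ (Unique.filter⁺ P? (subsets-unique n)) λ D∈ →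
      let _ , γD , v∈D = ∈-filter⁻ P? {xs = subsets n} D∈ in complete γD v∈D
      where P? = λ D → γtSet? G D ×-dec (v ∈? D)

    ≤TDV : {xs : List A} (f : A → Subset n) → Unique xs →
      (∀ {x} → x ∈ₗ xs → γtSet G (f x) × v ∈ f x) →
      (∀ {x x′} → x ∈ₗ xs → x′ ∈ₗ xs → f x ≡ f x′ → x ≡ x′) → length xs ≤ TDV G v
    ≤TDV f uxs sound = pigeonhole f uxs
      λ x∈ → ∈-filter⁺ (λ D → γtSet? G D ×-dec (v ∈? D)) (∈-subsets _) (sound x∈)

  -- The two non-neighbours of a vertex of degree n - 3.

  record NonNeighbours (v y z : Fin n) : Set where
    field
      y≢v   : y ≢ v
      z≢v   : z ≢ v
      y≢z   : y ≢ z
      ¬vy   : ¬ Adj v y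
      ¬vz   : ¬ Adj v z
      cover : ∀ u → u ≡ v ⊎ Adj v u ⊎ u ≡ y ⊎ u ≡ z

  -- Lets the lemmas about a common neighbour of `v` and `y` be reused for `v` and `z`.
  NonNeighbours-sym : ∀ {v y z} → NonNeighbours v y z → NonNeighbours v z y
  NonNeighbours-sym N = record
    { y≢v = z≢v ; z≢v = y≢v ; y≢z = y≢z ∘ sym ; ¬vy = ¬vz ; ¬vz = ¬vy
    ; cover = map₂ (map₂ swap) ∘ cover }
    where open NonNeighbours N

  -- The complement of N(v) has n - (n - 3) = 3 elements, one of which is `v`; the other two are y
  -- and z.
  nonNeighbours : 3 ≤ n → ∀ v → degree G v ≡ n ∸ 3 → ∃₂ (NonNeighbours v)
  nonNeighbours 3≤n v deg = go (elements p) (elements-unique p) len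
      (∈-elements⁺ (x∉p⇒x∈∁p λ v∈ → adj-irrefl (∈-neighbourhood⁻ v∈)))
      (λ ¬a → ∈-elements⁺ (x∉p⇒x∈∁p λ u∈ → ¬a (∈-neighbourhood⁻ u∈)))
      (λ u∈ a → x∈∁p⇒x∉p (∈-elements⁻ p u∈) (∈-neighbourhood⁺ a))
    where
    p = ∁ (neighbourhood G v)
    len : length (elements p) ≡ 3
    len = trans (length-elements p) (trans (∣∁p∣≡n∸∣p∣ (neighbourhood G v))
            (trans (cong (n ∸_) deg) (m∸[m∸n]≡n 3≤n)))

    build : ∀ {y z} → y ≢ v → z ≢ v → y ≢ z → ¬ Adj v y → ¬ Adj v z →
      (∀ {u} → ¬ Adj v u → u ≡ v ⊎ u ≡ y ⊎ u ≡ z) → ∃₂ (NonNeighbours v)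
    build {y} {z} y≢v z≢v y≢z ¬vy ¬vz c = y , z , record
      { y≢v = y≢v ; z≢v = z≢v ; y≢z = y≢z ; ¬vy = ¬vy ; ¬vz = ¬vz ; cover = cover′ }
      where
      cover′ : ∀ u → u ≡ v ⊎ Adj v u ⊎ u ≡ y ⊎ u ≡ z
      cover′ u with adj? v u
      ... | yes a = inj₂ (inj₁ a)
      ... | no ¬a with c ¬a
      ...   | inj₁ u≡v = inj₁ u≡v
      ...   | inj₂ u≡  = inj₂ (inj₂ u≡)

    go : ∀ xs → Unique xs → length xs ≡ 3 → v ∈ₗ xs → (∀ {u} → ¬ Adj v u → u ∈ₗ xs) →
      (∀ {u} → u ∈ₗ xs → ¬ Adj v u) → ∃₂ (NonNeighbours v)
    -- The position of `v` among the three entries decides which two serve as y and z.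
    go (a ∷ b ∷ c ∷ []) ((a≢b ∷ a≢c ∷ []) ∷ (b≢c ∷ []) ∷ [] ∷ []) refl v∈ compl snd = case v∈
      where
      case : v ∈ₗ a ∷ b ∷ c ∷ [] → ∃₂ (NonNeighbours v)
      case (here refl) = build (a≢b ∘ sym) (a≢c ∘ sym) b≢c
        (snd (there (here refl))) (snd (there (there (here refl)))) λ ¬a → split (compl ¬a)
        where
        split : ∀ {u} → u ∈ₗ a ∷ b ∷ c ∷ [] → u ≡ a ⊎ u ≡ b ⊎ u ≡ c
        split (here e)                 = inj₁ e
        split (there (here e))         = inj₂ (inj₁ e)
        split (there (there (here e))) = inj₂ (inj₂ e)
      case (there (here refl)) = build a≢b (b≢c ∘ sym) a≢c
        (snd (here refl)) (snd (there (there (here refl)))) λ ¬a → split (compl ¬a)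
        where
        split : ∀ {u} → u ∈ₗ a ∷ b ∷ c ∷ [] → u ≡ b ⊎ u ≡ a ⊎ u ≡ c
        split (here e)                 = inj₂ (inj₁ e)
        split (there (here e))         = inj₁ e
        split (there (there (here e))) = inj₂ (inj₂ e)
      case (there (there (here refl))) = build a≢c b≢c a≢b
        (snd (here refl)) (snd (there (here refl))) λ ¬a → split (compl ¬a)
        where
        split : ∀ {u} → u ∈ₗ a ∷ b ∷ c ∷ [] → u ≡ c ⊎ u ≡ a ⊎ u ≡ b
        split (here e)                 = inj₂ (inj₁ e)
        split (there (here e))         = inj₂ (inj₂ e)
        split (there (there (here e))) = inj₁ e

  -- Connectivity and vertices joining N(v) to y or z.

  module _ (noIso : NoIsolatedVertices G) {v y z : Fin n} (N : NonNeighbours v y z) where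
    open NonNeighbours N

    private
      reachable⇒connected : (∀ u → Star Adj v u) → Connected G
      reachable⇒connected r u w = reverse adj-sym (r u) ◅◅ r w

    -- Through `a`, `v` reaches `y`. The vertex `z` is not isolated, and its neighbour is neither
    -- `v` nor `z`, hence lies in N(v) or is `y`; so `z` is reached too.
    bridge⇒connected : ∀ {a} → Adj v a → Adj y a → Connected G
    bridge⇒connected {a} va ya = reachable⇒connected reach
      where
      v⟶y : Star Adj v y
      v⟶y = va ◅ adj-sym ya ◅ ε
      v⟶z : Star Adj v z
      v⟶z with noIso z
      ... | w , zw with cover w
      ...   | inj₁ refl               = contradiction (adj-sym zw) ¬vz
      ...   | inj₂ (inj₁ vw)          = vw ◅ adj-sym zw ◅ ε
      ...   | inj₂ (inj₂ (inj₁ refl)) = v⟶y ◅◅ adj-sym zw ◅ ε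
      ...   | inj₂ (inj₂ (inj₂ refl)) = contradiction zw adj-irrefl
      reach : ∀ u → Star Adj v u
      reach u with cover u
      ... | inj₁ refl               = ε
      ... | inj₂ (inj₁ vu)          = vu ◅ ε
      ... | inj₂ (inj₂ (inj₁ refl)) = v⟶y
      ... | inj₂ (inj₂ (inj₂ refl)) = v⟶z

    -- Here `a` dominates `v` and `y`, `v` dominates N(v), and `w` dominates `z`.
    bridge⇒dominating : ∀ {a w} → Adj v a → Adj y a → Adj z w →
      TotalDominating G (fromList (v ∷ a ∷ w ∷ []))
    bridge⇒dominating {a} {w} va ya zw u with cover u
    ... | inj₁ refl               = a , ∈-fromList⁺ (v ∷ a ∷ w ∷ []) (there (here refl)) , va
    ... | inj₂ (inj₁ vu)          = v , ∈-fromList⁺ (v ∷ a ∷ w ∷ []) (here refl) , adj-sym vu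
    ... | inj₂ (inj₂ (inj₁ refl)) = a , ∈-fromList⁺ (v ∷ a ∷ w ∷ []) (there (here refl)) , ya
    ... | inj₂ (inj₂ (inj₂ refl)) = w , ∈-fromList⁺ (v ∷ a ∷ w ∷ []) (there (there (here refl))) , zw

    bridge⇒γt≤3 : ∀ {a} → Adj v a → Adj y a → γt G ≤ 3
    bridge⇒γt≤3 va ya = ≤-trans (γt≤ (bridge⇒dominating va ya (proj₂ (noIso z))))
      (∣fromList∣≤length (v ∷ _ ∷ _ ∷ []))

    -- Source of n ≥ 5 in the connected case: the degree of `a` is at most Δ = n - 3.
    bridge⇒2≤degree : ∀ {a} → Adj v a → Adj y a → 2 ≤ degree G a
    bridge⇒2≤degree {a} va ya = length≤∣ neighbourhood G a ∣ {v ∷ y ∷ []}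
      ((y≢v ∘ sym ∷ []) ∷ [] ∷ [])
      (∈-neighbourhood⁺ (adj-sym va) ∷ ∈-neighbourhood⁺ (adj-sym ya) ∷ [])

    -- Taking w = a, the dominating triple {v, a, w} collapses to {v, a}.
    common-neighbour⇒γt≤2 : ∀ {a} → Adj v a → Adj y a → Adj z a → γt G ≤ 2
    common-neighbour⇒γt≤2 {a} va ya za = ≤-trans (γt≤ dominating) (∣fromList∣≤length (v ∷ a ∷ []))
      where
      dominating : TotalDominating G (fromList (v ∷ a ∷ []))
      dominating u with bridge⇒dominating va ya za u
      ... | w , w∈ , uw with ∈-fromList⁻ (v ∷ a ∷ a ∷ []) w∈
      ...   | here refl                 = v , ∈-fromList⁺ (v ∷ a ∷ []) (here refl) , uw
      ...   | there (here refl)         = a , ∈-fromList⁺ (v ∷ a ∷ []) (there (here refl)) , uw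
      ...   | there (there (here refl)) = a , ∈-fromList⁺ (v ∷ a ∷ []) (there (here refl)) , uw

    -- Without such an `a`, no edge leaves the closed neighbourhood of `v`, so no walk from `v` ends
    -- at `y`.
    connected⇒bridge : Connected G → ∃ λ a → Adj v a × (Adj y a ⊎ Adj z a)
    connected⇒bridge conn with any? (λ a → adj? v a ×-dec (adj? y a ⊎-dec adj? z a))
    ... | yes found = found
    ... | no  none  = ⊥-elim (y∉ (closed (conn v y) (inj₁ refl)))
      where
      y∉ : ¬ (y ≡ v ⊎ Adj v y)
      y∉ (inj₁ e) = y≢v e
      y∉ (inj₂ a) = ¬vy a
      step : ∀ {u w} → Adj u w → u ≡ v ⊎ Adj v u → w ≡ v ⊎ Adj v w
      step uw (inj₁ refl) = inj₂ uw
      step {u} {w} uw (inj₂ vu) with cover w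
      ... | inj₁ w≡v                = inj₁ w≡v
      ... | inj₂ (inj₁ vw)          = inj₂ vw
      ... | inj₂ (inj₂ (inj₁ refl)) = contradiction (u , vu , inj₁ (adj-sym uw)) none
      ... | inj₂ (inj₂ (inj₂ refl)) = contradiction (u , vu , inj₂ (adj-sym uw)) none
      closed : ∀ {u w} → Star Adj u w → u ≡ v ⊎ Adj v u → w ≡ v ⊎ Adj v w
      closed ε          c = c
      closed (uw ◅ wx)  c = closed wx (step uw c)

    -- Minimum total dominating sets of size 2 and 3.

    2≤γt : 2 ≤ n → 2 ≤ γt G
    2≤γt 2≤n = ≤γt 2≤n λ {D} td →
      let a , a∈D , _  = td v
          b , b∈D , ab = td a
      in length≤∣ D ∣ ((Adj⇒≢ ab ∷ []) ∷ [] ∷ []) (a∈D ∷ b∈D ∷ [])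

    -- The second member of a γt-set through `v` must dominate `v`, so it lies in N(v) and
    -- determines the set.
    TDV-when-γt≡2 : γt G ≡ 2 → TDV G v ≤ degree G v
    TDV-when-γt≡2 γ≡2 = begin
      TDV G v                                      ≤⟨ TDV≤ v (map f (elements Nv)) complete ⟩
      length (map f (elements Nv))                 ≡⟨ length-map f (elements Nv) ⟩
      length (elements Nv)                         ≡⟨ length-elements Nv ⟩
      degree G v                                   ∎
      where
      open ≤-Reasoning
      Nv = neighbourhood G v
      f = λ a → fromList (v ∷ a ∷ [])
      complete : ∀ {D} → γtSet G D → v ∈ D → D ∈ₗ map f (elements Nv)
      complete {D} (td , ∣D∣≡γ) v∈D with td v
      ... | a , a∈D , va = subst (_∈ₗ map f (elements Nv))
        (sym (≡fromList D ((Adj⇒≢ va ∷ []) ∷ [] ∷ []) (v∈D ∷ a∈D ∷ []) (trans ∣D∣≡γ γ≡2)))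
        (∈-map⁺ f (∈-elements⁺ (∈-neighbourhood⁺ va)))

    -- Let `a` and `b` in D dominate `y` and `z`. Each of them lies in N(v), unless `a` is `z` or
    -- `b` is `y`. The possible combinations give {v, a, b}, {v, y, a} and {v, z, b}, listed as
    -- `Ds₁`, `Ds₂` and `Ds₃`.
    TDV-when-γt≡3 : γt G ≡ 3 →
      TDV G v ≤ codegree v y * codegree v z + (codegree v y + codegree v z)
    TDV-when-γt≡3 γ≡3 = begin
      TDV G v          ≤⟨ TDV≤ v triples complete ⟩
      length triples   ≡⟨ length-triples ⟩
      codegree v y * codegree v z + (codegree v y + codegree v z) ∎
      where
      open ≤-Reasoning
      common : Fin n → List (Fin n)
      common u = elements (neighbourhood G v ∩ neighbourhood G u)

      triple : Fin n → Fin n → Subset n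
      triple a b = fromList (v ∷ a ∷ b ∷ [])

      Ds₁ = cartesianProductWith triple (common y) (common z)
      Ds₂ = map (triple y) (common y)
      Ds₃ = map (triple z) (common z)
      triples = Ds₁ ++ Ds₂ ++ Ds₃

      length-common : ∀ u → length (common u) ≡ codegree v u
      length-common u = length-elements (neighbourhood G v ∩ neighbourhood G u)

      length-triples : length triples ≡ codegree v y * codegree v z + (codegree v y + codegree v z)
      length-triples = trans (length-++ Ds₁) (cong₂ _+_
        (trans (length-cartesianProductWith triple (common y) (common z))
               (cong₂ _*_ (length-common y) (length-common z)))
        (trans (length-++ Ds₂) (cong₂ _+_
          (trans (length-map (triple y) (common y)) (length-common y))
          (trans (length-map (triple z) (common z)) (length-common z)))))

      ∈-common : ∀ {u a} → Adj v a → Adj u a → a ∈ₗ common u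
      ∈-common va ua = ∈-elements⁺ (x∈p∩q⁺ (∈-neighbourhood⁺ va , ∈-neighbourhood⁺ ua))

      complete : ∀ {D} → γtSet G D → v ∈ D → D ∈ₗ triples
      complete {D} (td , ∣D∣≡γ) v∈D with td y | td z
      ... | a , a∈D , ya | b , b∈D , zb = case (cover a) (cover b)
        where
        ∣D∣≡3 : ∣ D ∣ ≡ 3
        ∣D∣≡3 = trans ∣D∣≡γ γ≡3

        is-triple : ∀ {c d} → v ≢ c → v ≢ d → c ≢ d → c ∈ D → d ∈ D → triple c d ∈ₗ triples →
          D ∈ₗ triples
        is-triple v≢c v≢d c≢d c∈D d∈D = subst (_∈ₗ triples) (sym (≡fromList D
          ((v≢c ∷ v≢d ∷ []) ∷ (c≢d ∷ []) ∷ [] ∷ []) (v∈D ∷ c∈D ∷ d∈D ∷ []) ∣D∣≡3))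

        case : a ≡ v ⊎ Adj v a ⊎ a ≡ y ⊎ a ≡ z → b ≡ v ⊎ Adj v b ⊎ b ≡ y ⊎ b ≡ z → D ∈ₗ triples
        case (inj₁ refl) _ = contradiction (adj-sym ya) ¬vy
        case (inj₂ (inj₂ (inj₁ refl))) _ = contradiction ya adj-irrefl
        case _ (inj₁ refl) = contradiction (adj-sym zb) ¬vz
        case _ (inj₂ (inj₂ (inj₂ refl))) = contradiction zb adj-irrefl
        case (inj₂ (inj₁ va)) (inj₂ (inj₁ vb)) = is-triple (Adj⇒≢ va) (Adj⇒≢ vb) a≢b a∈D b∈D
          (∈-++⁺ˡ (∈-cartesianProductWith⁺ triple (∈-common va ya) (∈-common vb zb)))
          where
          a≢b : a ≢ b
          -- If a = b, this vertex is adjacent to all of v, y and z, which forces γt ≤ 2.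
          a≢b refl = <⇒≱ (s≤s (common-neighbour⇒γt≤2 va ya zb)) (≤-reflexive (sym γ≡3))
        case (inj₂ (inj₁ va)) (inj₂ (inj₂ (inj₁ refl))) =
          is-triple (y≢v ∘ sym) (Adj⇒≢ va) (Adj⇒≢ ya) b∈D a∈D
          (∈-++⁺ʳ Ds₁ (∈-++⁺ˡ (∈-map⁺ (triple y) (∈-common va ya))))
        case (inj₂ (inj₂ (inj₂ refl))) (inj₂ (inj₁ vb)) =
          is-triple (z≢v ∘ sym) (Adj⇒≢ vb) (Adj⇒≢ zb) a∈D b∈D
          (∈-++⁺ʳ Ds₁ (∈-++⁺ʳ Ds₂ (∈-map⁺ (triple z) (∈-common vb zb))))
        -- Now D contains v, y and z, none of which dominates `v`; its dominator `c` is a fourth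
        -- member.
        case (inj₂ (inj₂ (inj₂ refl))) (inj₂ (inj₂ (inj₁ refl))) with td v
        ... | c , c∈D , vc = contradiction (subst (4 ≤_) ∣D∣≡3 (length≤∣ D ∣
            ((y≢v ∘ sym ∷ z≢v ∘ sym ∷ Adj⇒≢ vc ∷ []) ∷
             (y≢z ∷ (λ { refl → ¬vy vc }) ∷ []) ∷ ((λ { refl → ¬vz vc }) ∷ []) ∷ [] ∷ [])
            (v∈D ∷ b∈D ∷ a∈D ∷ c∈D ∷ []))) 1+n≰n

    codegrees≤degree : γt G ≡ 3 → codegree v y + codegree v z ≤ degree G v
    codegrees≤degree γ≡3 = disjoint-∩-≤ (neighbourhood G v) (neighbourhood G y) (neighbourhood G z)
      λ va ya za → <⇒≱ (s≤s (common-neighbour⇒γt≤2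
        (∈-neighbourhood⁻ va) (∈-neighbourhood⁻ ya) (∈-neighbourhood⁻ za))) (≤-reflexive (sym γ≡3))

    -- The disconnected case, in which {y, z} is a component.

    module _ (¬vya : ∀ {a} → Adj v a → ¬ Adj y a) (¬vza : ∀ {a} → Adj v a → ¬ Adj z a) where

      private
        only-z : ∀ {w} → Adj y w → w ≡ z
        only-z {w} yw with cover w
        ... | inj₁ refl               = contradiction (adj-sym yw) ¬vy
        ... | inj₂ (inj₁ vw)          = contradiction yw (¬vya vw)
        ... | inj₂ (inj₂ (inj₁ refl)) = contradiction yw adj-irrefl
        ... | inj₂ (inj₂ (inj₂ w≡z))  = w≡z

        only-y : ∀ {w} → Adj z w → w ≡ y
        only-y {w} zw with cover w
        ... | inj₁ refl               = contradiction (adj-sym zw) ¬vz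
        ... | inj₂ (inj₁ vw)          = contradiction zw (¬vza vw)
        ... | inj₂ (inj₂ (inj₁ w≡y))  = w≡y
        ... | inj₂ (inj₂ (inj₂ refl)) = contradiction zw adj-irrefl

        yz : Adj y z
        yz = subst (Adj y) (only-z (proj₂ (noIso y))) (proj₂ (noIso y))

        -- Only `y` is available to dominate `z`.
        y∈ : ∀ {D} → TotalDominating G D → y ∈ D
        y∈ td with td z
        ... | w , w∈D , zw = subst (_∈ _) (only-y zw) w∈D

        z∈ : ∀ {D} → TotalDominating G D → z ∈ D
        z∈ td with td y
        ... | w , w∈D , yw = subst (_∈ _) (only-z yw) w∈D

        quad : Fin n → List (Fin n)
        quad a = y ∷ z ∷ v ∷ a ∷ []

        y≢nbr : ∀ {a} → Adj v a → y ≢ a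
        y≢nbr va refl = ¬vy va

        z≢nbr : ∀ {a} → Adj v a → z ≢ a
        z≢nbr va refl = ¬vz va

        quad-unique : ∀ {a} → Adj v a → Unique (quad a)
        quad-unique va =
          (y≢z ∷ y≢v ∷ y≢nbr va ∷ []) ∷ (z≢v ∷ z≢nbr va ∷ []) ∷ (Adj⇒≢ va ∷ []) ∷ [] ∷ []

        quad-dominating : ∀ {a} → Adj v a → TotalDominating G (fromList (quad a))
        quad-dominating {a} va u with cover u
        ... | inj₁ refl               = a , ∈-fromList⁺ (quad a) (there (there (there (here refl)))) , va
        ... | inj₂ (inj₁ vu)          = v , ∈-fromList⁺ (quad a) (there (there (here refl))) , adj-sym vu
        ... | inj₂ (inj₂ (inj₁ refl)) = z , ∈-fromList⁺ (quad a) (there (here refl)) , yz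
        ... | inj₂ (inj₂ (inj₂ refl)) = y , ∈-fromList⁺ (quad a) (here refl) , adj-sym yz

        -- Besides `y` and `z`, D contains a neighbour `a` of `v` and a neighbour `b` of `a`. Since
        -- `a` is adjacent to neither `y` nor `z`, all four are distinct; `b` may be `v`.
        4≤∣_∣ : ∀ D → TotalDominating G D → 4 ≤ ∣ D ∣
        4≤∣ D ∣ td with td v
        ... | a , a∈D , va with td a
        ...   | b , b∈D , ab = length≤∣ D ∣
          ((y≢z ∷ y≢nbr va ∷ y≢b ∷ []) ∷ (z≢nbr va ∷ z≢b ∷ []) ∷ (Adj⇒≢ ab ∷ []) ∷ [] ∷ [])
          (y∈ td ∷ z∈ td ∷ a∈D ∷ b∈D ∷ [])
          where
          y≢b : y ≢ b
          y≢b refl = ¬vya va (adj-sym ab)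
          z≢b : z ≢ b
          z≢b refl = ¬vza va (adj-sym ab)

      detached⇒γt≡4 : 4 ≤ n → γt G ≡ 4
      detached⇒γt≡4 4≤n = ≤-antisym
        (≤-trans (γt≤ (quad-dominating (proj₂ (noIso v)))) (∣fromList∣≤length (quad _)))
        (≤γt 4≤n λ {D} → 4≤∣ D ∣)

      -- The γt-sets through `v` correspond bijectively to the neighbours `a` of `v` via {y, z, v,
      -- a}; the two inequalities are the two directions of this count.
      detached⇒TDV≡degree : 4 ≤ n → TDV G v ≡ degree G v
      detached⇒TDV≡degree 4≤n = ≤-antisym upper lower
        where
        open ≤-Reasoning
        Nv = neighbourhood G v
        f = fromList ∘ quad
        γ≡4 = detached⇒γt≡4 4≤n

        complete : ∀ {D} → γtSet G D → v ∈ D → D ∈ₗ map f (elements Nv)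
        complete {D} (td , ∣D∣≡γ) v∈D with td v
        ... | a , a∈D , va = subst (_∈ₗ map f (elements Nv))
          (sym (≡fromList D (quad-unique va) (y∈ td ∷ z∈ td ∷ v∈D ∷ a∈D ∷ []) (trans ∣D∣≡γ γ≡4)))
          (∈-map⁺ f (∈-elements⁺ (∈-neighbourhood⁺ va)))

        upper : TDV G v ≤ degree G v
        upper = begin
          TDV G v                        ≤⟨ TDV≤ v (map f (elements Nv)) complete ⟩
          length (map f (elements Nv))   ≡⟨ length-map f (elements Nv) ⟩
          length (elements Nv)           ≡⟨ length-elements Nv ⟩
          degree G v                     ∎

        adj : ∀ {a} → a ∈ₗ elements Nv → Adj v a
        adj = ∈-neighbourhood⁻ ∘ ∈-elements⁻ Nv

        f-injective : ∀ {a b} → a ∈ₗ elements Nv → b ∈ₗ elements Nv → f a ≡ f b → a ≡ b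
        f-injective {a} {b} a∈ b∈ eq with ∈-fromList⁻ (quad b)
          (subst (a ∈_) eq (∈-fromList⁺ (quad a) (there (there (there (here refl))))))
        ... | here a≡y                        = contradiction (sym a≡y) (y≢nbr (adj a∈))
        ... | there (here a≡z)                = contradiction (sym a≡z) (z≢nbr (adj a∈))
        ... | there (there (here a≡v))        = contradiction (sym a≡v) (Adj⇒≢ (adj a∈))
        ... | there (there (there (here a≡b))) = a≡b

        lower : degree G v ≤ TDV G v
        lower = begin
          degree G v             ≡⟨ length-elements Nv ⟨
          length (elements Nv)   ≤⟨ ≤TDV v f (elements-unique Nv)
            (λ {a} a∈ → (quad-dominating (adj a∈) , trans (∣fromList∣≡length (quad-unique (adj a∈))) (sym γ≡4))
                  , ∈-fromList⁺ (quad a) (there (there (here refl))))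
            f-injective ⟩
          TDV G v                ∎

-- Arithmetic of the bound for γt = 3.

4pq≤[p+q]² : ∀ p q → 4 * (p * q) ≤ (p + q) * (p + q)
4pq≤[p+q]² p q = case ≤-total p q of λ where
    (inj₁ p≤q) → ordered p≤q
    (inj₂ q≤p) → subst₂ _≤_ (cong (4 *_) (*-comm q p)) (cong₂ _*_ (+-comm q p) (+-comm q p))
      (ordered q≤p)
  where
  -- With q = p + d this is (p + q)² = 4pq + (q - p)², free of subtraction.
  expand : ∀ p d → (p + (p + d)) * (p + (p + d)) ≡ 4 * (p * (p + d)) + d * d
  expand = solve-∀
  ordered : ∀ {p q} → p ≤ q → 4 * (p * q) ≤ (p + q) * (p + q)
  ordered {p} {q} p≤q = subst (λ q → 4 * (p * q) ≤ (p + q) * (p + q)) (m+[n∸m]≡n p≤q)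
    (subst (4 * (p * (p + (q ∸ p))) ≤_) (sym (expand p (q ∸ p))) (m≤m+n _ _))

-- Clears denominators: the right-hand side has the unreduced denominator 4, coming from the square
-- of m/2.
≤-quarter-square : ∀ {k m j} → k * 4 ≤ m * m + 2 * j * 4 →
  (+ k) / 1 ≤ℚ (((+ m) / 2) *ℚ ((+ m) / 2)) +ℚ (((+ 2) / 1) *ℚ ((+ j) / 1))
≤-quarter-square {k} {m} {j} h = *≤* (subst₂ ℤ._≤_ (ℤ.pos-* k 4) numerator (ℤ.+≤+ h))
  where
  open ≡-Reasoning
  numerator : + (m * m + 2 * j * 4) ≡
    ((+ m ℤ.* + m) ℤ.* + 1 ℤ.+ (+ 2 ℤ.* + j) ℤ.* + 4) ℤ.* + 1
  numerator = begin
    + (m * m) ℤ.+ + (2 * j * 4)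
      ≡⟨ cong₂ ℤ._+_ (ℤ.pos-* m m) (trans (ℤ.pos-* (2 * j) 4) (cong (ℤ._* + 4) (ℤ.pos-* 2 j))) ⟩
    + m ℤ.* + m ℤ.+ (+ 2 ℤ.* + j) ℤ.* + 4
      ≡⟨ cong (ℤ._+ (+ 2 ℤ.* + j) ℤ.* + 4) (ℤ.*-identityʳ (+ m ℤ.* + m)) ⟨
    (+ m ℤ.* + m) ℤ.* + 1 ℤ.+ (+ 2 ℤ.* + j) ℤ.* + 4
      ≡⟨ ℤ.*-identityʳ _ ⟨
    ((+ m ℤ.* + m) ℤ.* + 1 ℤ.+ (+ 2 ℤ.* + j) ℤ.* + 4) ℤ.* + 1 ∎

-- The product pq is at most (m/2)² by the inequality between the arithmetic and geometric means,
-- and the linear term p + q is at most m, hence at most 2j.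
pq+p+q-bound : ∀ {k} p q {m j} → k ≤ p * q + (p + q) → p + q ≤ m → m ≤ 2 * j →
  k * 4 ≤ m * m + 2 * j * 4
pq+p+q-bound {k} p q {m} {j} k≤ p+q≤m m≤2j = begin
  k * 4                              ≤⟨ *-monoˡ-≤ 4 k≤ ⟩
  (p * q + (p + q)) * 4              ≡⟨ *-distribʳ-+ 4 (p * q) (p + q) ⟩
  p * q * 4 + (p + q) * 4            ≡⟨ cong (_+ (p + q) * 4) (*-comm (p * q) 4) ⟩
  4 * (p * q) + (p + q) * 4          ≤⟨ +-mono-≤ (4pq≤[p+q]² p q) (*-monoˡ-≤ 4 (≤-trans p+q≤m m≤2j)) ⟩
  (p + q) * (p + q) + 2 * j * 4      ≤⟨ +-monoˡ-≤ _ (*-mono-≤ p+q≤m p+q≤m) ⟩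
  m * m + 2 * j * 4                  ∎
  where open ≤-Reasoning

-- For n = 4 + j it reads 1 + j ≤ 2j, that is 1 ≤ j; it fails at n = 4, which is why n ≥ 5 has to be
-- established first.
n∸3≤2[n∸4] : ∀ n → 2 ≤ n ∸ 3 → n ∸ 3 ≤ 2 * (n ∸ 4)
n∸3≤2[n∸4] (suc (suc (suc (suc j)))) (s≤s 1≤j) = +-mono-≤ 1≤j (≤-reflexive (sym (+-identityʳ j)))

-- Assembly of the disconnected and connected cases.

theorem2p17 : ∀ (n : ℕ) → 4 ≤ n → (G : Graph n) →
    NoIsolatedVertices G → Δ G ≡ n ∸ 3 →
    (v : Fin n) → degree G v ≡ Δ G →
    (¬ Connected G → γt G ≡ 4 × TDV G v ≡ n ∸ 3)
    ×
    (Connected G →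
    (γt G ≡ 2 × TDV G v ≤ n ∸ 3)
    ⊎
    (γt G ≡ 3 ×
    (+ TDV G v) / 1
    ≤ℚ (((+ (n ∸ 3)) / 2) *ℚ ((+ (n ∸ 3)) / 2)) +ℚ (((+ 2) / 1) *ℚ ((+ (n ∸ 4)) / 1))))
theorem2p17 n 4≤n G noIso Δ≡ v deg≡Δ
  with nonNeighbours G (<⇒≤ 4≤n) v (trans deg≡Δ Δ≡)
... | y , z , N = disconnected , connected
  where
  deg≡ : degree G v ≡ n ∸ 3
  deg≡ = trans deg≡Δ Δ≡

  N′ : NonNeighbours G v z y
  N′ = NonNeighbours-sym G N

  disconnected : ¬ Connected G → γt G ≡ 4 × TDV G v ≡ n ∸ 3
  disconnected ¬conn = detached⇒γt≡4 G noIso N ¬vya ¬vza 4≤n ,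
    trans (detached⇒TDV≡degree G noIso N ¬vya ¬vza 4≤n) deg≡
    where
    ¬vya : ∀ {a} → Graph.Adj G v a → ¬ Graph.Adj G y a
    ¬vya va ya = ¬conn (bridge⇒connected G noIso N va ya)
    ¬vza : ∀ {a} → Graph.Adj G v a → ¬ Graph.Adj G z a
    ¬vza va za = ¬conn (bridge⇒connected G noIso N′ va za)

  -- Both bounds come from one vertex `a` adjacent to `v` and to `y` or `z`; the second alternative
  -- is the first with `y` and `z` exchanged.
  γt≤3×2≤Δ : Connected G → γt G ≤ 3 × 2 ≤ n ∸ 3
  γt≤3×2≤Δ conn with connected⇒bridge G noIso N conn
  ... | a , va , inj₁ ya = bridge⇒γt≤3 G noIso N va ya ,
    subst (2 ≤_) Δ≡ (≤-trans (bridge⇒2≤degree G noIso N va ya) (degree≤Δ G a))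
  ... | a , va , inj₂ za = bridge⇒γt≤3 G noIso N′ va za ,
    subst (2 ≤_) Δ≡ (≤-trans (bridge⇒2≤degree G noIso N′ va za) (degree≤Δ G a))

  connected : Connected G → _ ⊎ _
  connected conn with γt≤3×2≤Δ conn
  ... | γ≤3 , 2≤n∸3 with m≤n⇒m<n∨m≡n γ≤3
  ...   | inj₁ γ<3 = inj₁ (γ≡2 , subst (TDV G v ≤_) deg≡ (TDV-when-γt≡2 G noIso N γ≡2))
    where
    γ≡2 : γt G ≡ 2
    γ≡2 = ≤-antisym (≤-pred γ<3) (2≤γt G noIso N (≤-trans (s≤s (s≤s z≤n)) 4≤n))
  ...   | inj₂ γ≡3 = inj₂ (γ≡3 , ≤-quarter-square {TDV G v} {n ∸ 3} {n ∸ 4}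
    (pq+p+q-bound (codegree G v y) (codegree G v z) {j = n ∸ 4} (TDV-when-γt≡3 G noIso N γ≡3)
      (subst (codegree G v y + codegree G v z ≤_) deg≡ (codegrees≤degree G noIso N γ≡3)) (n∸3≤2[n∸4] n 2≤n∸3)))
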